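{- Let $G=(V,E)$ be a finite connected undirected graph, $q\in V$, and $\sigma$ any total ordering of $E$. Then there exists a bijection $\pi:\mathcal{P}(G,q)\to\mathcal{T}(G)$ such that for every maximal $f\in\mathcal{P}(G,q)$, the tree $\pi(f)$ is safe with respect to $\sigma$.
   Context: For $A\subseteq V$ and $v\in A$, $d_{\overline{A}}(v)$ denotes the number of edges $vw$ with $w\notin A$. A $G$-parking function with respect to $q$ is a function $f:V\to\mathbb{Z}_{\geq -1}$ with $f(q)=-1$ such that for every non-empty $A\subseteq V\setminus\{q\}$ there exists $v\in A$ with $0\leq f(v)<d_{\overline{A}}(v)$; $\mathcal{P}(G,q)$ denotes the set of these. They are partially ordered by $g\prec f$ iff $g(v)\le f(v)$ for all $v$; maximal means maximal in this order. $\mathcal{T}(G)$ is the set of spanning trees of $G$. A spanning tree $T$ is safe with respect to $\sigma$ if for every edge $e\notin T$, the unique cycle in $T+e$ contains an edge $f$ with $\sigma(f)>\sigma(e)$. -}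

module Defs where

open import Data.Nat using (ℕ; _<_)
open import Data.Integer using (ℤ; +_; -[1+_]) renaming (_≤_ to _≤ℤ_; _<_ to _<ℤ_)
open import Data.Fin using (Fin; _≟_)
open import Data.Fin.Subset using (Subset; _∈_; _∉_; _∪_; ⁅_⁆; ⊤; Nonempty)
open import Data.Fin.Subset.Properties using (_∈?_)
open import Data.Bool using (Bool; _∧_; _∨_; not)
open import Data.List using (List; []; _∷_; length; filterᵇ; allFin)
open import Data.List.Relation.Unary.Unique.Propositional using (Unique)
import Data.List.Membership.Propositional as LM
open import Data.Vec using (Vec; lookup)
open import Data.Product using (Σ; ∃; ∃-syntax; _×_; _,_; proj₁; proj₂)
open import Data.Sum using (_⊎_)
open import Data.Empty using (⊥)
open import Relation.Nullary using (¬_)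
open import Relation.Nullary.Decidable using (⌊_⌋)
open import Relation.Binary.PropositionalEquality using (_≡_; _≢_)

-- A finite loopless undirected multigraph with vertex set Fin n and edge set
-- Fin m; edge e joins the two (distinct) vertices of  ends e .
record Graph (n m : ℕ) : Set where
  field
    ends     : Fin m → Fin n × Fin n
    loopless : ∀ e → proj₁ (ends e) ≢ proj₂ (ends e)

module _ {n m : ℕ} (G : Graph n m) where
  open Graph G

  Joins : Fin m → Fin n → Fin n → Set
  Joins e u w = (ends e ≡ (u , w)) ⊎ (ends e ≡ (w , u))

  data Walk (S : Subset m) : Fin n → Fin n → List (Fin m) → List (Fin n) → Set where
    nil  : ∀ {v} → Walk S v v [] []
    step : ∀ {u w v e es vs} → e ∈ S → Joins e u w →
           Walk S w v es vs → Walk S u (v) (e ∷ es) (w ∷ vs)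

  -- (v , es , vs) is a cycle of the spanning subgraph with edge set S:
  -- a non-empty closed walk at v with pairwise distinct edges and pairwise
  -- distinct vertices (vs contains v once, as its last entry).
  IsCycle : Subset m → Fin n → List (Fin m) → List (Fin n) → Set
  IsCycle S v es vs = Walk S v v es vs × (es ≢ []) × Unique es × Unique vs

  ConnectedSub : Subset m → Set
  ConnectedSub S = ∀ (u v : Fin n) → ∃[ es ] ∃[ vs ] Walk S u v es vs

  Acyclic : Subset m → Set
  Acyclic S = ∀ v es vs → ¬ IsCycle S v es vs

  IsSpanningTree : Subset m → Set
  IsSpanningTree T = ConnectedSub T × Acyclic T

  Connected : Set
  Connected = ConnectedSub ⊤

  outEdge : Subset n → Fin n → Fin m → Bool
  outEdge A v e =
    (⌊ proj₁ (ends e) ≟ v ⌋ ∧ not ⌊ proj₂ (ends e) ∈? A ⌋) ∨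
    (⌊ proj₂ (ends e) ≟ v ⌋ ∧ not ⌊ proj₁ (ends e) ∈? A ⌋)

  dOut : Subset n → Fin n → ℕ
  dOut A v = length (filterᵇ (outEdge A v) (allFin m))

  IsParking : Fin n → Vec ℤ n → Set
  IsParking q f =
    (lookup f q ≡ -[1+ 0 ]) ×
    (∀ v → -[1+ 0 ] ≤ℤ lookup f v) ×
    (∀ (A : Subset n) → Nonempty A → q ∉ A →
       ∃[ v ] (v ∈ A × (+ 0 ≤ℤ lookup f v) × (lookup f v <ℤ + dOut A v)))

  _≼_ : Vec ℤ n → Vec ℤ n → Set
  g ≼ f = ∀ v → lookup g v ≤ℤ lookup f v

  IsMaximalParking : Fin n → Vec ℤ n → Set
  IsMaximalParking q f =
    IsParking q f × (∀ g → IsParking q g → f ≼ g → g ≡ f)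

  -- T is safe w.r.t. σ (a total order on E, given as an injective rank σ : E → ℕ):
  -- for every e ∉ T, the cycle in T + e contains an edge f with σ f > σ e.
  Safe : (Fin m → ℕ) → Subset m → Set
  Safe σ T = ∀ e → e ∉ T → ∀ v es vs → IsCycle (T ∪ ⁅ e ⁆) v es vs →
             ∃[ f ] (f LM.∈ es × σ e < σ f)

{-# OPTIONS --safe #-}
module Submission where

-- Burn the graph from q (Cori–Le Borgne): repeatedly take the σ-least unprocessed
-- edge e from a burnt vertex to an unburnt vertex v, and either put e into the tree
-- and burn v, or reject e. A parking function f makes the choice by burning v when
-- f v equals the number of edges at v processed so far; a tree T, by testing e ∈ T.
-- Since the candidate depends only on the burnt and processed sets, either outcome
-- determines the run, so the two rules give inverse maps. An edge that is never
-- processed would allow f to be increased at the end burnt last; hence for maximal f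
-- every non-tree edge was rejected, and then it was σ-least across the cut between
-- burnt and unburnt vertices, a cut which its fundamental cycle crosses again.

open import Defs
open import Data.Bool using (Bool; true; false; not; _∧_) renaming (T to True)
open import Data.Bool.Properties using (T-∧; T-∨)
open import Data.Empty using (⊥-elim)
open import Data.Nat using (ℕ; zero; suc; z≤n; s≤s; _≤_; _<_)
import Data.Nat.Properties as ℕₚ
open import Data.Integer using (ℤ; +_; -[1+_]; +≤+; -≤+; +<+) renaming (_≤_ to _≤ℤ_; _<_ to _<ℤ_)
import Data.Integer.Properties as ℤₚ
open import Data.Fin using (Fin; zero; suc; _≟_)
open import Data.Fin.Properties using (any?)
open import Data.Fin.Subset using (Subset; _∈_; _∉_; _⊆_; _⊂_; _∪_; ∁; ⁅_⁆; ⊥)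
open import Data.Fin.Subset.Properties
  using (_∈?_; ∉⊥; x∈⁅x⁆; x∈⁅y⁆⇒x≡y; x∈p∪q⁺; x∈p∪q⁻; ⊆-antisym; x∈p⇒x∉∁p; x∈∁p⇒x∉p; x∉∁p⇒x∈p; x∉p⇒x∈∁p)
open import Data.Fin.Subset.Induction using (⊃-wellFounded; Acc; acc)
open import Data.List using (List; []; _∷_; length; filterᵇ; allFin)
open import Data.List.Membership.Propositional using () renaming (_∈_ to _∈ₗ_)
open import Data.List.Membership.Propositional.Properties using (∈-allFin)
open import Data.List.Relation.Unary.All as All using ([])
open import Data.List.Relation.Unary.All.Properties using (¬Any⇒All¬)
open import Data.List.Relation.Unary.Any as Any using (here; there)
open import Data.List.Relation.Unary.AllPairs using ([]; _∷_)
open import Data.List.Relation.Unary.Unique.Propositional using (Unique)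
open import Data.List.Relation.Unary.Unique.Propositional.Properties using (allFin⁺)
open import Data.Product using (Σ; ∃-syntax; _×_; _,_; proj₁; proj₂)
open import Data.Product.Properties using (≡-dec)
open import Data.Sum as Sum using (_⊎_; inj₁; inj₂; [_,_]′)
open import Data.Vec using (Vec; lookup; replicate; tabulate; _[_]≔_)
open import Data.Vec.Properties
  using ([]≔-idempotent; []≔-commutes; lookup-replicate; lookup∘update; lookup∘update′;
         tabulate∘lookup; tabulate-cong)
open import Function using (_∘_; id)
open import Function.Bundles using (Equivalence)
open import Function.Definitions using (Injective)
open import Relation.Binary.Construct.Closure.ReflexiveTransitive using (Star; ε; _◅_)
open import Relation.Binary.PropositionalEquality
  using (_≡_; _≢_; refl; sym; trans; cong; subst)
open import Relation.Nullary using (¬_; Dec; yes; no; contradiction)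
open import Relation.Nullary.Decidable
  using (⌊_⌋; toWitness; fromWitness; _×-dec_; _⊎-dec_; ¬?)
open import Relation.Unary using (Decidable)

open Equivalence using (to; from)

-- Counting list elements that pass a test

count : ∀ {A : Set} → (A → Bool) → List A → ℕ
count p xs = length (filterᵇ p xs)

count-mono : ∀ {A : Set} (p r : A → Bool) xs →
             (∀ x → x ∈ₗ xs → True (p x) → True (r x)) → count p xs ≤ count r xs
count-mono p r [] h = z≤n
count-mono p r (x ∷ xs) h with p x | r x | h x (here refl)
... | false | false | _ = count-mono p r xs (λ y → h y ∘ there)
... | false | true  | _ = ℕₚ.m≤n⇒m≤1+n (count-mono p r xs (λ y → h y ∘ there))
... | true  | true  | _ = s≤s (count-mono p r xs (λ y → h y ∘ there))
... | true  | false | k = ⊥-elim (k _)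

count-strict : ∀ {A : Set} (p r : A → Bool) xs {y} →
               (∀ x → True (p x) → True (r x)) →
               y ∈ₗ xs → ¬ True (p y) → True (r y) → count p xs < count r xs
count-strict p r (x ∷ xs) h (here refl) ¬py ry with p x | r x
... | false | true = s≤s (count-mono p r xs (λ y _ → h y))
... | true  | _    = ⊥-elim (¬py _)
count-strict p r (x ∷ xs) h (there y∈) ¬py ry with p x | r x | h x
... | false | false | _ = count-strict p r xs h y∈ ¬py ry
... | false | true  | _ = ℕₚ.m≤n⇒m≤1+n (count-strict p r xs h y∈ ¬py ry)
... | true  | true  | _ = s≤s (count-strict p r xs h y∈ ¬py ry)
... | true  | false | k = ⊥-elim (k _)

-- Without repetitions in `xs` the exceptional element `y` is met at most once; past it, every
-- element passing `p` also passes `r`.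
count-≤-suc : ∀ {A : Set} (p r : A → Bool) xs y → Unique xs →
              (∀ x → True (p x) → True (r x) ⊎ x ≡ y) → count p xs ≤ suc (count r xs)
count-≤-suc p r [] y _ h = z≤n
count-≤-suc p r (x ∷ xs) y (x# ∷ xs!) h with p x | r x | h x
... | false | false | _ = count-≤-suc p r xs y xs! h
... | false | true  | _ = ℕₚ.m≤n⇒m≤1+n (count-≤-suc p r xs y xs! h)
... | true  | true  | _ = s≤s (count-≤-suc p r xs y xs! h)
... | true  | false | k with k _
...   | inj₂ refl = s≤s (count-mono p r xs λ z z∈ pz →
                      [ id , (λ { refl → contradiction refl (All.lookup x# z∈) }) ]′ (h z pz))

count-positive : ∀ {A : Set} (p : A → Bool) xs {k} → k < count p xs → ∃[ x ] True (p x)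
count-positive p (x ∷ xs) k< with p x in eq
... | false = count-positive p xs k<
... | true  = x , subst True (sym eq) _

-- Least elements, one-element extensions of subsets, conversions

argmin-Fin : ∀ {m} (σ : Fin m → ℕ) {Q : Fin m → Set} → Decidable Q →
             (∃[ e ] (Q e × ∀ e′ → Q e′ → σ e ≤ σ e′)) ⊎ (∀ e → ¬ Q e)
argmin-Fin {zero} σ Q? = inj₂ λ ()
argmin-Fin {suc m} σ Q? with Q? zero | argmin-Fin (σ ∘ suc) (Q? ∘ suc)
... | no ¬q | inj₂ none = inj₂ λ { zero → ¬q ; (suc e) → none e }
... | no ¬q | inj₁ (e , qe , min) =
  inj₁ (suc e , qe , λ { zero q → contradiction q ¬q ; (suc e′) → min e′ })
... | yes q | inj₂ none =
  inj₁ (zero , q , λ { zero _ → ℕₚ.≤-refl ; (suc e′) q′ → contradiction q′ (none e′) })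
... | yes q | inj₁ (e , qe , min) with ℕₚ.≤-total (σ zero) (σ (suc e))
...   | inj₁ 0≤ = inj₁ (zero , q , λ { zero _ → ℕₚ.≤-refl ; (suc e′) q′ → ℕₚ.≤-trans 0≤ (min e′ q′) })
...   | inj₂ ≤0 = inj₁ (suc e , qe , λ { zero _ → ≤0 ; (suc e′) → min e′ })

infixl 6 _⊕_
_⊕_ : ∀ {k} → Subset k → Fin k → Subset k
p ⊕ x = p ∪ ⁅ x ⁆

⊕-old : ∀ {k} {p : Subset k} {x y} → y ∈ p → y ∈ p ⊕ x
⊕-old = x∈p∪q⁺ ∘ inj₁

⊕-new : ∀ {k} {p : Subset k} {x} → x ∈ p ⊕ x
⊕-new {x = x} = x∈p∪q⁺ (inj₂ (x∈⁅x⁆ x))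

⊕⁻ : ∀ {k} (p : Subset k) {x y} → y ∈ p ⊕ x → y ∈ p ⊎ y ≡ x
⊕⁻ p {x} = Sum.map₂ (x∈⁅y⁆⇒x≡y x) ∘ x∈p∪q⁻ p ⁅ x ⁆

⊕-⊂ : ∀ {k} {p : Subset k} {x} → x ∉ p → p ⊂ p ⊕ x
⊕-⊂ {x = x} x∉p = ⊕-old , x , ⊕-new , x∉p

lookup-ext : ∀ {A : Set} {k} (xs ys : Vec A k) → (∀ i → lookup xs i ≡ lookup ys i) → xs ≡ ys
lookup-ext xs ys h = trans (sym (tabulate∘lookup xs)) (trans (tabulate-cong h) (tabulate∘lookup ys))

nat-bounds : ∀ {z k d} → z ≡ + k → k < d → + 0 ≤ℤ z × z <ℤ + d
nat-bounds refl k<d = +≤+ z≤n , +<+ k<d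

nat-below : ∀ {z d} → + 0 ≤ℤ z → z <ℤ + d → ∃[ k ] (z ≡ + k × k < d)
nat-below {+ k} _ (+<+ k<d) = k , refl , k<d

∧-not⁺ : ∀ {P Q : Set} (p? : Dec P) (q? : Dec Q) → P → ¬ Q → True (⌊ p? ⌋ ∧ not ⌊ q? ⌋)
∧-not⁺ (yes _) (no _)  _ _  = _
∧-not⁺ (yes _) (yes q) _ ¬q = ¬q q
∧-not⁺ (no ¬p) _       p _  = ¬p p

∧-not⁻ : ∀ {P Q : Set} (p? : Dec P) (q? : Dec Q) → True (⌊ p? ⌋ ∧ not ⌊ q? ⌋) → P × ¬ Q
∧-not⁻ (yes p) (no ¬q) _ = p , ¬q

module _ {n m : ℕ} (G : Graph n m) where
  open Graph G using (ends; loopless)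

  -- Edges, incidence and degrees

  joins-sym : ∀ {e u v} → Joins G e u v → Joins G e v u
  joins-sym = Sum.swap

  joins-unique : ∀ {e u v x y} → Joins G e u v → Joins G e x y →
                 (x ≡ u × y ≡ v) ⊎ (x ≡ v × y ≡ u)
  joins-unique (inj₁ p) (inj₁ r) with refl ← trans (sym p) r = inj₁ (refl , refl)
  joins-unique (inj₁ p) (inj₂ r) with refl ← trans (sym p) r = inj₂ (refl , refl)
  joins-unique (inj₂ p) (inj₁ r) with refl ← trans (sym p) r = inj₂ (refl , refl)
  joins-unique (inj₂ p) (inj₂ r) with refl ← trans (sym p) r = inj₁ (refl , refl)

  no-loop : ∀ {e v} {A : Set} → Joins G e v v → A
  no-loop {e} (inj₁ eq) = contradiction (trans (cong proj₁ eq) (sym (cong proj₂ eq))) (loopless e)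
  no-loop {e} (inj₂ eq) = contradiction (trans (cong proj₁ eq) (sym (cong proj₂ eq))) (loopless e)

  joins? : ∀ e u v → Dec (Joins G e u v)
  joins? e u v = ≡-dec _≟_ _≟_ (ends e) (u , v) ⊎-dec ≡-dec _≟_ _≟_ (ends e) (v , u)

  outEdge⁺ : ∀ A {e u v} → Joins G e u v → u ∉ A → True (outEdge G A v e)
  outEdge⁺ A {e} {u} {v} j u∉A = from (T-∨ {x = ⌊ x ≟ v ⌋ ∧ not ⌊ y ∈? A ⌋}) (side j)
    where
    x = proj₁ (ends e)
    y = proj₂ (ends e)
    side : Joins G e u v → True (⌊ x ≟ v ⌋ ∧ not ⌊ y ∈? A ⌋) ⊎ True (⌊ y ≟ v ⌋ ∧ not ⌊ x ∈? A ⌋)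
    side (inj₁ eq) = inj₂ (∧-not⁺ (y ≟ v) (x ∈? A) (cong proj₂ eq) (u∉A ∘ subst (_∈ A) (cong proj₁ eq)))
    side (inj₂ eq) = inj₁ (∧-not⁺ (x ≟ v) (y ∈? A) (cong proj₁ eq) (u∉A ∘ subst (_∈ A) (cong proj₂ eq)))

  outEdge⁻ : ∀ A {e v} → True (outEdge G A v e) → ∃[ u ] (Joins G e u v × u ∉ A)
  outEdge⁻ A {e} {v} t = [ first , second ]′ (to (T-∨ {x = ⌊ x ≟ v ⌋ ∧ not ⌊ y ∈? A ⌋}) t)
    where
    x = proj₁ (ends e)
    y = proj₂ (ends e)
    first : True (⌊ x ≟ v ⌋ ∧ not ⌊ y ∈? A ⌋) → ∃[ u ] (Joins G e u v × u ∉ A)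
    first t₁ = let eq , y∉A = ∧-not⁻ (x ≟ v) (y ∈? A) t₁ in y , inj₂ (cong (_, y) eq) , y∉A
    second : True (⌊ y ≟ v ⌋ ∧ not ⌊ x ∈? A ⌋) → ∃[ u ] (Joins G e u v × u ∉ A)
    second t₂ = let eq , x∉A = ∧-not⁻ (y ≟ v) (x ∈? A) t₂ in x , inj₁ (cong (x ,_) eq) , x∉A

  -- outEdge G ⊥ v  recognises the edges incident with v.
  degreeIn : Subset m → Fin n → ℕ
  degreeIn P v = count (λ e → ⌊ e ∈? P ⌋ ∧ outEdge G ⊥ v e) (allFin m)

  incident⁺ : ∀ {P e u v} → e ∈ P → Joins G e u v → True (⌊ e ∈? P ⌋ ∧ outEdge G ⊥ v e)
  incident⁺ e∈P j = from T-∧ (fromWitness e∈P , outEdge⁺ ⊥ j ∉⊥)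

  incident⁻ : ∀ {P e v} → True (⌊ e ∈? P ⌋ ∧ outEdge G ⊥ v e) → e ∈ P × ∃[ u ] Joins G e u v
  incident⁻ {P} {e} t with to (T-∧ {x = ⌊ e ∈? P ⌋}) t
  ... | e∈P , o with outEdge⁻ ⊥ {e} o
  ...   | u , j , _ = toWitness e∈P , u , j

  degreeIn-⊥ : ∀ v {k} → ¬ k < degreeIn ⊥ v
  degreeIn-⊥ v k< with count-positive _ (allFin m) k<
  ... | e , t = ∉⊥ (proj₁ (incident⁻ {e = e} t))

  degreeIn-mono : ∀ {P P′} v → P ⊆ P′ → degreeIn P v ≤ degreeIn P′ v
  degreeIn-mono v P⊆ = count-mono _ _ (allFin m) λ e _ t →
    let e∈ , _ , j = incident⁻ {e = e} t in incident⁺ (P⊆ e∈) j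

  degreeIn-strict : ∀ {P e u v} → e ∉ P → Joins G e u v → degreeIn P v < degreeIn (P ⊕ e) v
  degreeIn-strict {P} {e} e∉P j = count-strict _ _ (allFin m)
    (λ e′ t → let e∈ , _ , j′ = incident⁻ {e = e′} t in incident⁺ (⊕-old e∈) j′)
    (∈-allFin e) (e∉P ∘ proj₁ ∘ incident⁻) (incident⁺ (⊕-new {p = P}) j)

  degreeIn-⊕ : ∀ P e v → degreeIn (P ⊕ e) v ≤ suc (degreeIn P v)
  degreeIn-⊕ P e v = count-≤-suc _ _ (allFin m) e (allFin⁺ m) λ e′ t →
    let e∈ , _ , j = incident⁻ {e = e′} t in Sum.map₁ (λ e∈P → incident⁺ e∈P j) (⊕⁻ P e∈)

  degreeIn-⊕-other : ∀ P e v → (∀ u → ¬ Joins G e u v) → degreeIn (P ⊕ e) v ≤ degreeIn P v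
  degreeIn-⊕-other P e v ¬inc = count-mono _ _ (allFin m) λ e′ _ t →
    let e∈ , u , j = incident⁻ {e = e′} t in
    [ (λ e∈P → incident⁺ e∈P j) , (λ { refl → contradiction j (¬inc u) }) ]′ (⊕⁻ P e∈)

  -- Processed edges at `v` all lead into `B`, hence out of `∁ B`, and the unprocessed `e` is one
  -- more such edge. This makes the label given at burning small enough for the parking condition.
  degreeIn<dOut : ∀ {P B e u v} → (∀ {e u} → e ∈ P → Joins G e u v → u ∈ B) →
                  e ∉ P → u ∈ B → Joins G e u v → degreeIn P v < dOut G (∁ B) v
  degreeIn<dOut {P} {B} {e} inB e∉P u∈B j = count-strict _ _ (allFin m)
    (λ e′ t → let e∈ , _ , j′ = incident⁻ {e = e′} t in outEdge⁺ (∁ B) j′ (x∈p⇒x∉∁p (inB e∈ j′)))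
    (∈-allFin e) (e∉P ∘ proj₁ ∘ incident⁻) (outEdge⁺ (∁ B) j (x∈p⇒x∉∁p u∈B))

  dOut≤degreeIn : ∀ {P B v} → (∀ {e u} → Joins G e u v → u ∈ B → e ∈ P) →
                  dOut G (∁ B) v ≤ degreeIn P v
  dOut≤degreeIn {P} {B} inP = count-mono _ _ (allFin m) λ e _ t →
    let u , j , u∉ = outEdge⁻ (∁ B) {e} t in incident⁺ (inP j (x∉∁p⇒x∈p u∉)) j

  -- A set `A` disjoint from `B` lies in `∁ B`, and shrinking a set can only add edges from `v` that
  -- leave it.
  dOut-disjoint : ∀ {A B} v → (∀ {u} → u ∈ B → u ∉ A) → dOut G (∁ B) v ≤ dOut G A v
  dOut-disjoint {A} {B} v disj = count-mono _ _ (allFin m) λ e _ t →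
    let u , j , u∉ = outEdge⁻ (∁ B) {e} t in outEdge⁺ A j (disj (x∉∁p⇒x∈p u∉))

  -- Walks and cuts

  Crosses : Subset n → Fin m → Fin n → Set
  Crosses B e v = ∃[ u ] (u ∈ B × v ∉ B × Joins G e u v)

  Cut : Subset n → Fin m → Set
  Cut B e = ∃[ v ] Crosses B e v

  walk-edges : ∀ {S u v es vs e} → Walk G S u v es vs → e ∈ₗ es → e ∈ S
  walk-edges (step e∈S _ _) (here refl) = e∈S
  walk-edges (step _ _ w) (there e∈) = walk-edges w e∈

  walk-mono : ∀ {S S′ u v es vs} → (∀ {e} → e ∈ₗ es → e ∈ S → e ∈ S′) →
              Walk G S u v es vs → Walk G S′ u v es vs
  walk-mono h nil = nil
  walk-mono h (step e∈ j w) = step (h (here refl) e∈) j (walk-mono (h ∘ there) w)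

  walk-endpoint : ∀ {S u v es vs e x y} → Walk G S u v es vs → e ∈ₗ es → Joins G e x y → x ∈ₗ u ∷ vs
  walk-endpoint (step _ j _) (here refl) j′ with joins-unique j j′
  ... | inj₁ (refl , _) = here refl
  ... | inj₂ (refl , _) = there (here refl)
  walk-endpoint (step _ _ w) (there e∈) j′ = there (walk-endpoint w e∈ j′)

  walk-leaves : ∀ {S u v es vs} B → Walk G S u v es vs → u ∈ B → v ∉ B → ∃[ e ] (e ∈ₗ es × Cut B e)
  walk-leaves B nil u∈ v∉ = contradiction u∈ v∉
  walk-leaves B (step {w = w} {e = e} _ j p) u∈ v∉ with w ∈? B
  ... | no w∉ = e , here refl , w , _ , u∈ , w∉ , j
  ... | yes w∈ = let f , f∈ , c = walk-leaves B p w∈ v∉ in f , there f∈ , c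

  walk-enters : ∀ {S u v es vs} B → Walk G S u v es vs → u ∉ B → v ∈ B → ∃[ e ] (e ∈ₗ es × Cut B e)
  walk-enters B nil u∉ v∈ = contradiction v∈ u∉
  walk-enters B (step {w = w} {e = e} _ j p) u∉ v∈ with w ∈? B
  ... | yes w∈ = e , here refl , _ , w , w∈ , u∉ , joins-sym j
  ... | no w∉ = let f , f∈ , c = walk-enters B p w∉ v∈ in f , there f∈ , c

  trail-split : ∀ {S u v es vs e} → Walk G S u v es vs → Unique es → e ∈ₗ es →
    ∃[ x ] ∃[ y ] ∃[ es₁ ] ∃[ vs₁ ] ∃[ es₂ ] ∃[ vs₂ ]
      (Walk G S u x es₁ vs₁ × Joins G e x y × Walk G S y v es₂ vs₂ ×
       (∀ {f} → f ∈ₗ es₁ ⊎ f ∈ₗ es₂ → f ∈ₗ es × f ≢ e))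
  trail-split (step _ j w) (e# ∷ _) (here refl) =
    _ , _ , [] , [] , _ , _ , nil , j , w ,
    λ { (inj₂ f∈) → there f∈ , λ { refl → All.lookup e# f∈ refl } }
  trail-split (step e∈S j w) (e# ∷ es!) (there e∈) with trail-split w es! e∈
  ... | x , y , es₁ , vs₁ , es₂ , vs₂ , w₁ , j′ , w₂ , h =
    x , y , _ , _ , es₂ , vs₂ , step e∈S j w₁ , j′ , w₂ ,
    λ { (inj₁ (here refl)) → here refl , All.lookup e# e∈
      ; (inj₁ (there f∈)) → let f∈es , f≢ = h (inj₁ f∈) in there f∈es , f≢
      ; (inj₂ f∈) → let f∈es , f≢ = h (inj₂ f∈) in there f∈es , f≢ }

  -- Delete `e`: the two remaining pieces join the base point `v` to the two ends of `e`, which lie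
  -- on opposite sides of the cut. The piece reaching the side without `v` must cross, and
  -- distinctness of edges makes its crossing edge differ from `e`.
  closed-trail-recrosses : ∀ {S v es vs e} B → Walk G S v v es vs → Unique es → e ∈ₗ es → Cut B e →
                           ∃[ f ] (f ∈ₗ es × f ≢ e × Cut B f)
  closed-trail-recrosses {v = v} B w es! e∈ (b , a , a∈ , b∉ , j) with trail-split w es! e∈
  ... | x , y , es₁ , vs₁ , es₂ , vs₂ , w₁ , j′ , w₂ , h = cases (joins-unique j j′) (v ∈? B)
    where
    fst : ∃[ f ] (f ∈ₗ es₁ × Cut B f) → ∃[ f ] (f ∈ₗ _ × f ≢ _ × Cut B f)
    fst (f , f∈ , c) = let f∈es , f≢ = h (inj₁ f∈) in f , f∈es , f≢ , c
    snd : ∃[ f ] (f ∈ₗ es₂ × Cut B f) → ∃[ f ] (f ∈ₗ _ × f ≢ _ × Cut B f)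
    snd (f , f∈ , c) = let f∈es , f≢ = h (inj₂ f∈) in f , f∈es , f≢ , c
    cases : (x ≡ a × y ≡ b) ⊎ (x ≡ b × y ≡ a) → Dec (v ∈ B) → ∃[ f ] (f ∈ₗ _ × f ≢ _ × Cut B f)
    cases (inj₁ (refl , refl)) (yes v∈) = snd (walk-enters B w₂ b∉ v∈)
    cases (inj₁ (refl , refl)) (no v∉)  = fst (walk-enters B w₁ v∉ a∈)
    cases (inj₂ (refl , refl)) (yes v∈) = fst (walk-leaves B w₁ v∈ b∉)
    cases (inj₂ (refl , refl)) (no v∉)  = snd (walk-leaves B w₂ a∈ v∉)

  -- Connection, paths and cycles

  Linked : Subset m → Fin n → Fin n → Set
  Linked S u v = ∃[ es ] ∃[ vs ] Walk G S u v es vs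

  linked-mono : ∀ {S S′ u v} → S ⊆ S′ → Linked S u v → Linked S′ u v
  linked-mono S⊆ (_ , _ , w) = _ , _ , walk-mono (λ _ → S⊆) w

  linked-cons : ∀ {S e u v w} → e ∈ S → Joins G e u w → Linked S w v → Linked S u v
  linked-cons e∈ j (_ , _ , w) = _ , _ , step e∈ j w

  linked-snoc : ∀ {S e u v w} → Linked S u v → e ∈ S → Joins G e v w → Linked S u w
  linked-snoc (_ , _ , nil) e∈ j = linked-cons e∈ j (_ , _ , nil)
  linked-snoc (_ , _ , step f∈ j′ w) e∈ j = linked-cons f∈ j′ (linked-snoc (_ , _ , w) e∈ j)

  Path : Subset m → Fin n → Fin n → Set
  Path S u v = ∃[ es ] ∃[ vs ] (Walk G S u v es vs × Unique es × Unique (u ∷ vs))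

  path-suffix : ∀ {S u v x es vs} → Walk G S u v es vs → Unique es → Unique (u ∷ vs) →
                x ∈ₗ u ∷ vs → Path S x v
  path-suffix w es! vs! (here refl) = _ , _ , w , es! , vs!
  path-suffix (step _ _ w) (_ ∷ es!) (_ ∷ vs!) (there x∈) = path-suffix w es! vs! x∈

  -- Loop erasure: if the new first vertex already lies on the path, only the suffix from there is
  -- kept. Otherwise the new edge is fresh too, since an old occurrence would put its end `u` on the
  -- path.
  walk⇒path : ∀ {S u v es vs} → Walk G S u v es vs → Path S u v
  walk⇒path nil = [] , [] , nil , [] , [] ∷ []
  walk⇒path (step {u = u} e∈ j w) with walk⇒path w
  ... | es , vs , p , es! , vs! with Any.any? (u ≟_) (_ ∷ vs)
  ...   | yes u∈ = path-suffix p es! vs! u∈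
  ...   | no u∉ = _ , _ , step e∈ j p ,
                  ¬Any⇒All¬ es (λ e∈es → u∉ (walk-endpoint p e∈es j)) ∷ es! , ¬Any⇒All¬ _ u∉ ∷ vs!

  -- Shorten the link to a path from `y` to `x` and precede it by `e`. The vertex list of the
  -- resulting cycle is that of the path, start included, so its entries stay distinct.
  linked-chord-closes-cycle : ∀ {S T e x y} → S ⊆ T → Linked S y x → e ∈ T → e ∉ S → Joins G e x y →
                              ¬ Acyclic G T
  linked-chord-closes-cycle S⊆T (_ , _ , w) e∈T e∉S j acyclic with walk⇒path w
  ... | es , vs , p , es! , vs! =
    acyclic _ _ _ (step e∈T j (walk-mono (λ _ → S⊆T) p) , (λ ()) ,
      ¬Any⇒All¬ es (e∉S ∘ walk-edges p) ∷ es! , vs!)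

  cycle-through : ∀ {S e v es vs} → Acyclic G S → IsCycle G (S ⊕ e) v es vs → e ∈ₗ es
  cycle-through {S} {e} {es = es} acyclic (w , ≢[] , es! , vs!) with Any.any? (e ≟_) es
  ... | yes e∈ = e∈
  ... | no e∉ = contradiction (walk-mono drop w , ≢[] , es! , vs!) (acyclic _ _ _)
    where
    drop : ∀ {f} → f ∈ₗ es → f ∈ S ⊕ e → f ∈ S
    drop f∈ f∈⊕ = [ id , (λ { refl → contradiction f∈ e∉ }) ]′ (⊕⁻ S f∈⊕)

  -- A cycle of `S ⊕ e` must use `e`, as `S` has none; its second crossing avoids `e` and so lies in
  -- `S`. This serves both the acyclicity of the growing tree and safety.
  chord-recrosses : ∀ {S e v es vs} B → Acyclic G S → IsCycle G (S ⊕ e) v es vs → Cut B e →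
                    ∃[ f ] (f ∈ₗ es × f ∈ S × Cut B f)
  chord-recrosses {S} B acyclic c@(w , _ , es! , _) cut
    with closed-trail-recrosses B w es! (cycle-through acyclic c) cut
  ... | f , f∈ , f≢ , cutf =
    f , f∈ , [ id , (λ eq → contradiction eq f≢) ]′ (⊕⁻ S (walk-edges w f∈)) , cutf

  -- Burning the graph from q

  module Burning (q : Fin n) (σ : Fin m → ℕ) (σ-injective : Injective _≡_ _≡_ σ) where

    -- B: burnt vertices, P: processed edges, X: processed edges put into the tree.
    -- The label L is −1 on q and on the unburnt vertices.
    record State : Set where
      constructor state
      field
        B : Subset n
        P X : Subset m
        L : Vec ℤ n
    open State

    initial : State
    initial = state ⁅ q ⁆ ⊥ ⊥ (replicate n -[1+ 0 ])

    Next : State → Fin m → Fin n → Set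
    Next s e v = e ∉ P s × Crosses (B s) e v ×
                 (∀ e′ → e′ ∉ P s → Cut (B s) e′ → σ e ≤ σ e′)

    Halted : State → Set
    Halted s = ∀ e → e ∉ P s → ¬ Cut (B s) e

    label : State → Fin n → ℤ
    label s v = lookup (L s) v

    accepted : State → Fin m → Fin n → State
    accepted s e v = state (B s ⊕ v) (P s ⊕ e) (X s ⊕ e) (L s [ v ]≔ + degreeIn (P s) v)

    rejected : State → Fin m → State
    rejected s e = state (B s) (P s ⊕ e) (X s) (L s)

    -- The rule choosing between the outcomes is left open, so that one invariant covers runs driven
    -- by labels and runs driven by a tree.
    data Step (s : State) : State → Set where
      accept : ∀ {e v} → Next s e v → Step s (accepted s e v)
      reject : ∀ {e v} → Next s e v → Step s (rejected s e)

    Run : State → State → Set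
    Run = Star Step

    next? : ∀ s → (∃[ e ] ∃[ v ] Next s e v) ⊎ Halted s
    next? s with argmin-Fin σ {λ e → e ∉ P s × Cut (B s) e}
                  (λ e → ¬? (e ∈? P s) ×-dec any? λ v → any? λ u →
                         (u ∈? B s) ×-dec ¬? (v ∈? B s) ×-dec joins? e u v)
    ... | inj₁ (e , (e∉ , v , c) , min) = inj₁ (e , v , e∉ , c , λ e′ e′∉ c′ → min e′ (e′∉ , c′))
    ... | inj₂ none = inj₂ λ e e∉ c → none e (e∉ , c)

    -- Injectivity of `σ` makes the least candidate unique, and its end `v` is fixed because the
    -- other end is burnt.
    next-unique : ∀ {s e v e′ v′} → Next s e v → Next s e′ v′ → e ≡ e′ × v ≡ v′
    next-unique {e = e} {e′ = e′} (e∉ , (u , u∈ , v∉ , j) , min) (e′∉ , (u′ , u′∈ , v′∉ , j′) , min′)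
      with σ-injective {e} {e′} (ℕₚ.≤-antisym (min e′ e′∉ (_ , u′ , u′∈ , v′∉ , j′))
                                              (min′ e e∉ (_ , u , u∈ , v∉ , j)))
    ... | refl with joins-unique j j′
    ...   | inj₁ (_ , refl) = refl , refl
    ...   | inj₂ (refl , _) = contradiction u′∈ v∉

    step-⊃ : ∀ {s s′} → Step s s′ → P s ⊂ P s′
    step-⊃ (accept (e∉ , _)) = ⊕-⊂ e∉
    step-⊃ (reject (e∉ , _)) = ⊕-⊂ e∉

    run-preserves : (I : State → Set) → (∀ {s s′} → Step s s′ → I s → I s′) →
                    ∀ {s s′} → Run s s′ → I s → I s′
    run-preserves I h ε i = i
    run-preserves I h (x ◅ r) i = run-preserves I h r (h x i)

    -- Every step enlarges `P`, a subset of a finite set, so the run ends. `advance` supplies the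
    -- choice rule and carries `I` along.
    run-to-halt : (I : State → Set) →
                  (∀ {s e v} → Next s e v → I s → ∃[ s′ ] (Step s s′ × I s′)) →
                  ∀ s → I s → ∃[ s′ ] (Run s s′ × Halted s′ × I s′)
    run-to-halt I advance s = go s (⊃-wellFounded (P s))
      where
      go : ∀ s → Acc (λ p r → r ⊂ p) (P s) → I s → ∃[ s′ ] (Run s s′ × Halted s′ × I s′)
      go s (acc rec) i with next? s
      ... | inj₂ halted = s , ε , halted , i
      ... | inj₁ (e , v , nx) with advance nx i
      ...   | s₁ , x , i₁ with go s₁ (rec (step-⊃ x)) i₁
      ...     | s₂ , r , halted , i₂ = s₂ , x ◅ r , halted , i₂

    -- The parking condition restricted to the sets A that meet B.
    Good : Subset n → Vec ℤ n → Set
    Good B f = ∀ A → q ∉ A → ∃[ u ] (u ∈ A × u ∈ B) →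
               ∃[ v ] (v ∈ A × v ∈ B × + 0 ≤ℤ lookup f v × lookup f v <ℤ + dOut G A v)

    good-cong : ∀ {B f g} → (∀ v → v ∈ B → lookup g v ≡ lookup f v) → Good B f → Good B g
    good-cong eq good A q∉ meets with good A q∉ meets
    ... | v , v∈A , v∈B , 0≤ , < = v , v∈A , v∈B , subst (+ 0 ≤ℤ_) (sym (eq v v∈B)) 0≤
                                 , subst (_<ℤ + dOut G A v) (sym (eq v v∈B)) <

    -- If `A` meets `B`, the old witness still serves, as labels on `B` are unchanged. Otherwise `v`
    -- itself is the witness, and its bound against `∁ B` passes to the subset `A` of `∁ B`.
    good-extend : ∀ {B} f {v k} → Good B f → v ∉ B → k < dOut G (∁ B) v → Good (B ⊕ v) (f [ v ]≔ + k)
    good-extend {B} f {v} {k} good v∉ k< A q∉ (u , u∈A , u∈) with any? (λ x → (x ∈? A) ×-dec (x ∈? B))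
    ... | yes meets with good-cong {f = f} {g = f [ v ]≔ + k} agree good A q∉ meets
      where
      agree : ∀ x → x ∈ B → lookup (f [ v ]≔ + k) x ≡ lookup f x
      agree x x∈ = lookup∘update′ (λ { refl → v∉ x∈ }) f _
    ...   | x , x∈A , x∈B , bounds = x , x∈A , ⊕-old x∈B , bounds
    good-extend {B} f {v} {k} good v∉ k< A q∉ (u , u∈A , u∈) | no disjoint with ⊕⁻ B u∈
    ... | inj₁ u∈B = contradiction (u , u∈A , u∈B) disjoint
    ... | inj₂ refl = u , u∈A , ⊕-new ,
      nat-bounds (lookup∘update u f (+ k))
                 (ℕₚ.<-≤-trans k< (dOut-disjoint u λ x∈B x∈A → disjoint (_ , x∈A , x∈B)))

    -- Refutes maximality once everything is burnt; phrased relative to the burnt set so that it can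
    -- be carried through an unfinished run.
    Bumpable : Subset n → Vec ℤ n → Set
    Bumpable B f = ∃[ w ] ∃[ k ] (w ∈ B × w ≢ q × lookup f w ≡ + k × Good B (f [ w ]≔ + suc k))

    -- B₀ is the burnt set at the time e was rejected; every edge that is later
    -- accepted across this cut was a candidate then.
    SafeCut : State → Fin m → Set
    SafeCut s e = ∃[ B₀ ] (Cut B₀ e × ∀ f → f ∈ X s ⊎ f ∉ P s → Cut B₀ f → σ e < σ f)

    -- The invariant of a run

    record Inv (s : State) : Set where
      field
        root       : q ∈ B s
        touched    : ∀ {e u v} → e ∈ P s → Joins G e u v → v ∉ B s → u ∈ B s
        inside     : ∀ {e u v} → e ∈ X s → Joins G e u v → u ∈ B s
        subset     : X s ⊆ P s
        linked     : ∀ {u v} → u ∈ B s → v ∈ B s → Linked (X s) u v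
        acyclic    : Acyclic G (X s)
        unburnt    : ∀ {v} → v ∉ B s → label s v ≡ -[1+ 0 ]
        rootLabel  : label s q ≡ -[1+ 0 ]
        lowerBound : ∀ v → -[1+ 0 ] ≤ℤ label s v
        good       : Good (B s) (L s)
        -- An edge with both ends burnt is no longer a candidate; left unprocessed, it leaves slack
        -- in the label of the end burnt last.
        bumpable   : ∀ {e u v} → e ∉ P s → Joins G e u v → u ∈ B s → v ∈ B s → Bumpable (B s) (L s)
        safeCut    : ∀ {e} → e ∈ P s → e ∉ X s → SafeCut s e
    open Inv

    inside-uncut : ∀ {s f} → Inv s → f ∈ X s → ¬ Cut (B s) f
    inside-uncut inv f∈ (_ , _ , _ , v∉ , j) = v∉ (inside inv f∈ (joins-sym j))

    inv-initial : Inv initial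
    inv-initial = record
      { root = x∈⁅x⁆ q
      ; touched = λ e∈ → contradiction e∈ ∉⊥
      ; inside = λ e∈ → contradiction e∈ ∉⊥
      ; subset = id
      ; linked = λ u∈ v∈ → case-linked (x∈⁅y⁆⇒x≡y q u∈) (x∈⁅y⁆⇒x≡y q v∈)
      ; acyclic = λ { v _ _ (nil , ≢[] , _) → ≢[] refl ; v _ _ (step e∈ _ _ , _) → ∉⊥ e∈ }
      ; unburnt = λ {v} _ → lookup-replicate v _
      ; rootLabel = lookup-replicate q _
      ; lowerBound = λ v → ℤₚ.≤-reflexive (sym (lookup-replicate v _))
      ; good = λ A q∉ (u , u∈A , u∈) → contradiction (subst (_∈ A) (x∈⁅y⁆⇒x≡y q u∈) u∈A) q∉
      ; bumpable = λ {e} _ j u∈ v∈ →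
          no-loop {e} (subst (Joins G e _) (trans (x∈⁅y⁆⇒x≡y q v∈) (sym (x∈⁅y⁆⇒x≡y q u∈))) j)
      ; safeCut = λ e∈ → contradiction e∈ ∉⊥
      }
      where
      case-linked : ∀ {u v} → u ≡ q → v ≡ q → Linked ⊥ u v
      case-linked refl refl = [] , [] , nil

    -- An edge accepted now was unprocessed just before, so the bound on unprocessed edges already
    -- applied to it.
    safeCut-later : ∀ {s s′ e} → Step s s′ → SafeCut s e → SafeCut s′ e
    safeCut-later {s} (accept (e∉ , _)) (B₀ , cut , low) = B₀ , cut , λ
      { f (inj₁ f∈) → low f ([ inj₁ , (λ { refl → inj₂ e∉ }) ]′ (⊕⁻ (X s) f∈))
      ; f (inj₂ f∉) → low f (inj₂ (f∉ ∘ ⊕-old)) }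
    safeCut-later (reject _) (B₀ , cut , low) = B₀ , cut , λ f f∈ → low f (Sum.map₂ (_∘ ⊕-old) f∈)

    inv-reject : ∀ {s e v} → Next s e v → Inv s → Inv (rejected s e)
    inv-reject {s} {e} {v} nx@(e∉ , (u , u∈ , v∉ , j) , min) inv = record
      { root = root inv
      ; touched = λ e′∈ j′ y∉ → [ (λ e′∈P → touched inv e′∈P j′ y∉)
                                , (λ { refl → new-touched j′ y∉ }) ]′ (⊕⁻ (P s) e′∈)
      ; inside = inside inv
      ; subset = ⊕-old ∘ subset inv
      ; linked = linked inv
      ; acyclic = acyclic inv
      ; unburnt = unburnt inv
      ; rootLabel = rootLabel inv
      ; lowerBound = lowerBound inv
      ; good = good inv
      ; bumpable = λ e′∉ → bumpable inv (e′∉ ∘ ⊕-old)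
      ; safeCut = λ e′∈ e′∉X → [ (λ e′∈P → safeCut-later {s} (reject {s} nx) (safeCut inv e′∈P e′∉X))
                               , (λ { refl → new-safeCut }) ]′ (⊕⁻ (P s) e′∈)
      }
      where
      new-touched : ∀ {x y} → Joins G e x y → y ∉ B s → x ∈ B s
      new-touched j′ y∉ with joins-unique j j′
      ... | inj₁ (refl , _) = u∈
      ... | inj₂ (_ , refl) = contradiction u∈ y∉
      new-safeCut : SafeCut (rejected s e) e
      -- The present `B s` serves as `B₀`: tree edges do not cross it, and an unprocessed crossing
      -- edge was a competitor of `e`, strictly larger because `σ` is injective.
      new-safeCut = B s , (v , u , u∈ , v∉ , j) , λ
        { f (inj₁ f∈X) cut → contradiction cut (inside-uncut inv f∈X)
        ; f (inj₂ f∉) cut → ℕₚ.≤∧≢⇒< (min f (f∉ ∘ ⊕-old) cut)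
            (λ eq → f∉ (subst (_∈ P s ⊕ e) (σ-injective eq) ⊕-new)) }

    inv-accept : ∀ {s e v} → Next s e v → Inv s → Inv (accepted s e v)
    inv-accept {s} {e} {v} nx@(e∉ , (u , u∈ , v∉ , j) , min) inv = record
      { root = ⊕-old (root inv)
      ; touched = λ e′∈ j′ y∉ → [ (λ e′∈P → ⊕-old (touched inv e′∈P j′ (y∉ ∘ ⊕-old)))
                                , (λ { refl → new-inside j′ }) ]′ (⊕⁻ (P s) e′∈)
      ; inside = λ e′∈ j′ → [ (λ e′∈X → ⊕-old (inside inv e′∈X j′))
                            , (λ { refl → new-inside j′ }) ]′ (⊕⁻ (X s) e′∈)
      ; subset = λ e′∈ → [ ⊕-old ∘ subset inv , (λ { refl → ⊕-new }) ]′ (⊕⁻ (X s) e′∈)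
      ; linked = λ x∈ y∈ → new-linked (⊕⁻ (B s) x∈) (⊕⁻ (B s) y∈)
      ; acyclic = new-acyclic
      ; unburnt = λ x∉ → trans (lookup∘update′ (λ { refl → x∉ ⊕-new }) (L s) _) (unburnt inv (x∉ ∘ ⊕-old))
      ; rootLabel = trans (lookup∘update′ q≢v (L s) _) (rootLabel inv)
      ; lowerBound = new-lowerBound
      ; good = good-extend (L s) (good inv) v∉ bound
      ; bumpable = λ e′∉ j′ x∈ y∈ → new-bumpable e′∉ j′ (⊕⁻ (B s) x∈) (⊕⁻ (B s) y∈)
      ; safeCut = λ e′∈ e′∉X →
          [ (λ e′∈P → safeCut-later {s} (accept {s} nx) (safeCut inv e′∈P (e′∉X ∘ ⊕-old)))
          , (λ { refl → contradiction ⊕-new e′∉X }) ]′ (⊕⁻ (P s) e′∈)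
      }
      where
      d = degreeIn (P s) v
      q≢v : q ≢ v
      q≢v refl = v∉ (root inv)
      new-inside : ∀ {x y} → Joins G e x y → x ∈ B s ⊕ v
      new-inside j′ with joins-unique j j′
      ... | inj₁ (refl , _) = ⊕-old u∈
      ... | inj₂ (refl , _) = ⊕-new
      new-linked : ∀ {x y} → x ∈ B s ⊎ x ≡ v → y ∈ B s ⊎ y ≡ v → Linked (X s ⊕ e) x y
      new-linked (inj₁ x∈) (inj₁ y∈) = linked-mono ⊕-old (linked inv x∈ y∈)
      new-linked (inj₁ x∈) (inj₂ refl) = linked-snoc (linked-mono ⊕-old (linked inv x∈ u∈)) ⊕-new j
      new-linked (inj₂ refl) (inj₁ y∈) =
        linked-cons ⊕-new (joins-sym j) (linked-mono ⊕-old (linked inv u∈ y∈))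
      new-linked (inj₂ refl) (inj₂ refl) = [] , [] , nil
      -- A cycle through `e` would cross the boundary of `B s` a second time by an edge of `X s`,
      -- but those have both ends burnt.
      new-acyclic : Acyclic G (X s ⊕ e)
      new-acyclic _ _ _ c with chord-recrosses (B s) (acyclic inv) c (v , u , u∈ , v∉ , j)
      ... | f , _ , f∈X , cut = inside-uncut inv f∈X cut
      new-lowerBound : ∀ x → -[1+ 0 ] ≤ℤ lookup (L s [ v ]≔ + d) x
      new-lowerBound x with x ≟ v
      ... | yes refl rewrite lookup∘update x (L s) (+ d) = -≤+
      ... | no x≢v rewrite lookup∘update′ x≢v (L s) (+ d) = lowerBound inv x
      bound : d < dOut G (∁ (B s)) v
      bound = degreeIn<dOut (λ f∈ j′ → touched inv f∈ j′ v∉) e∉ u∈ j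
      -- Besides the `d` processed edges, both `e` and `e′` join `v` to `B s`, so the label `d` has
      -- room for one more.
      bound⁺ : ∀ {e′ x} → e′ ∉ P s ⊕ e → x ∈ B s → Joins G e′ x v → suc d < dOut G (∁ (B s)) v
      bound⁺ e′∉ x∈ j′ = ℕₚ.≤-<-trans (degreeIn-strict e∉ j) (degreeIn<dOut inB e′∉ x∈ j′)
        where
        inB : ∀ {f y} → f ∈ P s ⊕ e → Joins G f y v → y ∈ B s
        inB f∈ j″ with ⊕⁻ (P s) f∈
        ... | inj₁ f∈P = touched inv f∈P j″ v∉
        ... | inj₂ refl with joins-unique j j″
        ...   | inj₁ (refl , _) = u∈
        ...   | inj₂ (_ , refl) = contradiction u∈ v∉
      bump-new : suc d < dOut G (∁ (B s)) v → Bumpable (B s ⊕ v) (L s [ v ]≔ + d)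
      bump-new k< = v , d , ⊕-new , q≢v ∘ sym , lookup∘update v (L s) _ ,
        -- Raising the fresh label overwrites it, so the result is `L s` extended directly by
        -- `suc d`.
        subst (Good (B s ⊕ v)) (sym ([]≔-idempotent (L s) v)) (good-extend (L s) (good inv) v∉ k<)
      new-bumpable : ∀ {e′ x y} → e′ ∉ P s ⊕ e → Joins G e′ x y → x ∈ B s ⊎ x ≡ v → y ∈ B s ⊎ y ≡ v →
                     Bumpable (B s ⊕ v) (L s [ v ]≔ + d)
      new-bumpable e′∉ j′ (inj₁ x∈) (inj₂ refl) = bump-new (bound⁺ e′∉ x∈ j′)
      new-bumpable e′∉ j′ (inj₂ refl) (inj₁ y∈) = bump-new (bound⁺ e′∉ y∈ (joins-sym j′))
      new-bumpable {e′} e′∉ j′ (inj₂ refl) (inj₂ refl) = no-loop {e′} j′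
      new-bumpable e′∉ j′ (inj₁ x∈) (inj₁ y∈) with bumpable inv (e′∉ ∘ ⊕-old) j′ x∈ y∈
      ... | w , k , w∈ , w≢q , eq , good-w = w , k , ⊕-old w∈ , w≢q
        , trans (lookup∘update′ w≢v (L s) _) eq
        -- The earlier bump at `w` survives: `v` is burnt on top of the bumped labels, and updates
        -- at distinct vertices commute.
        , subst (Good (B s ⊕ v)) ([]≔-commutes (L s) w v w≢v)
            (good-extend (L s [ w ]≔ + suc k) good-w v∉ bound)
        where
        w≢v : w ≢ v
        w≢v refl = v∉ w∈

    inv-step : ∀ {s s′} → Step s s′ → Inv s → Inv s′
    inv-step (accept nx) = inv-accept nx
    inv-step (reject nx) = inv-reject nx

    -- A run is determined by either outcome

    -- Burnt vertices are never burnt again, so the label of `v` is frozen; and `X` only grows.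
    accepted-stays : ∀ {s e v s′} → e ∉ P s → v ∉ B s → Run (accepted s e v) s′ →
                     e ∈ X s′ × label s′ v ≡ + degreeIn (P s) v
    accepted-stays {s} {e} {v} e∉ v∉ r =
      let e∈ , _ , eq = run-preserves I pres r (⊕-new , ⊕-new , lookup∘update v (L s) _) in e∈ , eq
      where
      I : State → Set
      I s′ = e ∈ X s′ × v ∈ B s′ × label s′ v ≡ + degreeIn (P s) v
      pres : ∀ {s s′} → Step s s′ → I s → I s′
      pres {s₁} (accept (_ , (_ , _ , w∉ , _) , _)) (e∈ , v∈ , eq) =
        ⊕-old e∈ , ⊕-old v∈ , trans (lookup∘update′ (λ { refl → w∉ v∈ }) (L s₁) _) eq
      pres (reject _) i = i

    -- Once processed, `e` cannot enter the tree. While `v` is unburnt its label is -1 and its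
    -- processed degree exceeds the value at the rejection, so any label it gets later is larger.
    rejected-stays : ∀ {s e v s′} → Next s e v → Inv s → Run (rejected s e) s′ →
                     e ∉ X s′ × label s′ v ≢ + degreeIn (P s) v
    rejected-stays {s} {e} {v} (e∉ , (u , u∈ , v∉ , j) , _) inv r =
      let _ , e∉X , ≢ , _ = run-preserves I pres r
            (⊕-new , e∉ ∘ subset inv , (λ eq → -1≢+ (trans (sym (unburnt inv v∉)) eq))
            , λ _ → degreeIn-strict e∉ j)
      in e∉X , ≢
      where
      -1≢+ : ∀ {k} → -[1+ 0 ] ≢ + k
      -1≢+ ()
      I : State → Set
      I s′ = e ∈ P s′ × e ∉ X s′ × label s′ v ≢ + degreeIn (P s) v ×
             (v ∉ B s′ → degreeIn (P s) v < degreeIn (P s′) v)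
      pres : ∀ {s s′} → Step s s′ → I s → I s′
      pres {s₁} (accept {e = f} {v = w} (f∉ , (_ , _ , w∉ , _) , _)) (e∈ , e∉X , ≢ , lt) =
        ⊕-old e∈ , (λ e∈⊕ → [ e∉X , (λ { refl → f∉ e∈ }) ]′ (⊕⁻ (X s₁) e∈⊕)) , new-≢ ,
        λ v∉ → ℕₚ.<-≤-trans (lt (v∉ ∘ ⊕-old)) (degreeIn-mono v ⊕-old)
        where
        new-≢ : lookup (L s₁ [ w ]≔ + degreeIn (P s₁) w) v ≢ + degreeIn (P s) v
        new-≢ eq with v ≟ w
        ... | yes refl = ℕₚ.<⇒≢ (lt w∉) (sym (ℤₚ.+-injective (trans (sym (lookup∘update v (L s₁) _)) eq)))
        ... | no v≢w = ≢ (trans (sym (lookup∘update′ v≢w (L s₁) _)) eq)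
      pres (reject _) (e∈ , e∉X , ≢ , lt) =
        ⊕-old e∈ , e∉X , ≢ , λ v∉ → ℕₚ.<-≤-trans (lt v∉) (degreeIn-mono v ⊕-old)

    -- The disjunction lets a single uniqueness statement serve injectivity, through `X`, and
    -- surjectivity, through `L`.
    SameOutcome : State → State → Set
    SameOutcome s s′ = X s ≡ X s′ ⊎ L s ≡ L s′

    accept-reject-differ : ∀ {s e v s₁ s₂} → Next s e v → Inv s → Run (accepted s e v) s₁ →
                           Run (rejected s e) s₂ → ¬ SameOutcome s₁ s₂
    accept-reject-differ nx@(e∉ , (_ , _ , v∉ , _) , _) inv r₁ r₂ same
      with accepted-stays e∉ v∉ r₁ | rejected-stays nx inv r₂ | same
    ... | e∈ , _ | e∉X , _ | inj₁ refl = e∉X e∈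
    ... | _ , eq | _ , ≢   | inj₂ refl = ≢ eq

    -- While the runs agree they face the same candidate; at the first different decision
    -- `accept-reject-differ` separates both the trees and the labels. Haltedness keeps one run from
    -- outlasting the other.
    outcome-determines-run : ∀ {s s₁ s₂} → Inv s → Run s s₁ → Run s s₂ → Halted s₁ → Halted s₂ →
                             SameOutcome s₁ s₂ → s₁ ≡ s₂
    outcome-determines-run inv ε ε h₁ h₂ same = refl
    outcome-determines-run inv ε (accept (e∉ , c , _) ◅ _) h₁ h₂ same = contradiction (_ , c) (h₁ _ e∉)
    outcome-determines-run inv ε (reject (e∉ , c , _) ◅ _) h₁ h₂ same = contradiction (_ , c) (h₁ _ e∉)
    outcome-determines-run inv (accept (e∉ , c , _) ◅ _) ε h₁ h₂ same = contradiction (_ , c) (h₂ _ e∉)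
    outcome-determines-run inv (reject (e∉ , c , _) ◅ _) ε h₁ h₂ same = contradiction (_ , c) (h₂ _ e∉)
    outcome-determines-run {s} inv (accept nx ◅ r) (accept nx′ ◅ r′) h₁ h₂ same
      with refl , refl ← next-unique {s} nx nx′ =
        outcome-determines-run (inv-accept nx inv) r r′ h₁ h₂ same
    outcome-determines-run {s} inv (reject nx ◅ r) (reject nx′ ◅ r′) h₁ h₂ same
      with refl , refl ← next-unique {s} nx nx′ =
        outcome-determines-run (inv-reject nx inv) r r′ h₁ h₂ same
    outcome-determines-run {s} inv (accept nx ◅ r) (reject nx′ ◅ r′) h₁ h₂ same
      with refl , refl ← next-unique {s} nx nx′ = contradiction same (accept-reject-differ nx inv r r′)
    outcome-determines-run {s} inv (reject nx ◅ r) (accept nx′ ◅ r′) h₁ h₂ same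
      with refl , refl ← next-unique {s} nx nx′ =
        contradiction (Sum.map sym sym same) (accept-reject-differ nx inv r′ r)

    -- Runs driven by a labelling

    record FollowsLabels (f : Vec ℤ n) (s : State) : Set where
      field
        inv     : Inv s
        burnt   : ∀ {v} → v ∈ B s → v ≢ q → label s v ≡ lookup f v
        -- Each processed edge at an unburnt `v` was a failed test of `f v` against the count at
        -- that time, so all counts below the present one are ruled out.
        pending : ∀ {v k} → v ∉ B s → k < degreeIn (P s) v → lookup f v ≢ + k
    open FollowsLabels

    followsLabels-initial : ∀ f → FollowsLabels f initial
    followsLabels-initial f = record
      { inv = inv-initial
      ; burnt = λ v∈ v≢q → contradiction (x∈⁅y⁆⇒x≡y q v∈) v≢q
      ; pending = λ {v} _ k< → ⊥-elim (degreeIn-⊥ v k<)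
      }

    followsLabels-step : ∀ f {s e v} → Next s e v → FollowsLabels f s →
                         ∃[ s′ ] (Step s s′ × FollowsLabels f s′)
    followsLabels-step f {s} {e} {v} nx@(e∉ , (u , u∈ , v∉ , j) , _) fl
      with lookup f v ℤₚ.≟ + degreeIn (P s) v
    ... | yes eq = accepted s e v , accept nx , record
      { inv = inv-accept nx (inv fl)
      ; burnt = λ {w} w∈ w≢q → new-burnt w w≢q (⊕⁻ (B s) w∈)
      ; pending = λ {w} w∉ k< → pending fl (w∉ ∘ ⊕-old)
          (ℕₚ.<-≤-trans k< (degreeIn-⊕-other (P s) e w (λ x j′ → w∉ (other j′))))
      }
      where
      new-burnt : ∀ w → w ≢ q → w ∈ B s ⊎ w ≡ v → lookup (L s [ v ]≔ + degreeIn (P s) v) w ≡ lookup f w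
      new-burnt w w≢q (inj₁ w∈) = trans (lookup∘update′ (λ { refl → v∉ w∈ }) (L s) _) (burnt fl w∈ w≢q)
      new-burnt w w≢q (inj₂ refl) = trans (lookup∘update w (L s) _) (sym eq)
      other : ∀ {x w} → Joins G e x w → w ∈ B s ⊕ v
      other j′ with joins-unique j j′
      ... | inj₁ (_ , refl) = ⊕-new
      ... | inj₂ (_ , refl) = ⊕-old u∈
    ... | no ≢ = rejected s e , reject nx , record
      { inv = inv-reject nx (inv fl)
      ; burnt = burnt fl
      ; pending = new-pending
      }
      where
      new-pending : ∀ {w k} → w ∉ B s → k < degreeIn (P s ⊕ e) w → lookup f w ≢ + k
      new-pending {w} {k} w∉ k< with w ≟ v
      ... | no w≢v = pending fl w∉ (ℕₚ.<-≤-trans k< (degreeIn-⊕-other (P s) e w other))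
        where
        other : ∀ x → ¬ Joins G e x w
        other x j′ with joins-unique j j′
        ... | inj₁ (_ , refl) = w≢v refl
        ... | inj₂ (_ , refl) = w∉ u∈
      -- Processing `e` raises the count at `w` by at most one, so the only new value is the one
      -- whose test has just failed.
      ... | yes refl with ℕₚ.m≤n⇒m<n∨m≡n (ℕₚ.≤-pred (ℕₚ.<-≤-trans k< (degreeIn-⊕ (P s) e w)))
      ...   | inj₁ k<d = pending fl w∉ k<d
      ...   | inj₂ refl = ≢

    labelRun : ∀ f → ∃[ s ] (Run initial s × Halted s × FollowsLabels f s)
    labelRun f = run-to-halt (FollowsLabels f) (followsLabels-step f) initial (followsLabels-initial f)

    tree : Vec ℤ n → Subset m
    tree f = X (proj₁ (labelRun f))

    -- Dhar's argument: the parking condition for the unburnt set gives `w` with `f w` below its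
    -- number of edges into `B s`. At a halt all of these are processed, so `f w` would be a value
    -- that `pending` rules out.
    parking-burns-all : ∀ {f s} → IsParking G q f → Halted s → FollowsLabels f s → ∀ v → v ∈ B s
    parking-burns-all {f} {s} (_ , _ , park) halted fl v with v ∈? B s
    ... | yes v∈ = v∈
    ... | no v∉ with park (∁ (B s)) (v , x∉p⇒x∈∁p v∉) (x∈p⇒x∉∁p (root (inv fl)))
    ...   | w , w∈ , 0≤ , < with nat-below 0≤ <
    ...     | k , eq , k< = contradiction eq (pending fl w∉ (ℕₚ.<-≤-trans k< (dOut≤degreeIn processed)))
      where
      w∉ = x∈∁p⇒x∉p w∈
      processed : ∀ {e u} → Joins G e u w → u ∈ B s → e ∈ P s
      processed {e} j u∈ with e ∈? P s
      ... | yes e∈ = e∈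
      ... | no e∉ = contradiction (w , _ , u∈ , w∉ , j) (halted e e∉)

    parking-labels : ∀ {f s} → IsParking G q f → Halted s → FollowsLabels f s → L s ≡ f
    parking-labels {f} {s} pf halted fl = lookup-ext (L s) f agree
      where
      agree : ∀ v → label s v ≡ lookup f v
      agree v with v ≟ q
      ... | yes refl = trans (rootLabel (inv fl)) (sym (proj₁ pf))
      ... | no v≢q = burnt fl (parking-burns-all pf halted fl v) v≢q

    spanning : ∀ {s} → Inv s → (∀ v → v ∈ B s) → IsSpanningTree G (X s)
    spanning inv all = (λ u v → linked inv (all u) (all v)) , acyclic inv

    parking-tree : ∀ f → IsParking G q f → IsSpanningTree G (tree f)
    parking-tree f pf = let _ , _ , halted , fl = labelRun f in
      spanning (inv fl) (parking-burns-all pf halted fl)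

    -- Equal trees force the same run, whose final labels are both `f` and `g`.
    tree-injective : ∀ f g → IsParking G q f → IsParking G q g → tree f ≡ tree g → f ≡ g
    tree-injective f g pf pg eq =
      let s , r , halted , fl = labelRun f
          s′ , r′ , halted′ , fl′ = labelRun g
          s≡s′ = outcome-determines-run inv-initial r r′ halted halted′ (inj₁ eq)
      in trans (sym (parking-labels pf halted fl)) (trans (cong L s≡s′) (parking-labels pg halted′ fl′))

    -- Maximal parking functions give safe trees

    good-parking : ∀ {B} f → (∀ v → v ∈ B) → lookup f q ≡ -[1+ 0 ] → (∀ v → -[1+ 0 ] ≤ℤ lookup f v) →
                   Good B f → IsParking G q f
    good-parking f all fq low good = fq , low , λ A (u , u∈) q∉ →
      let v , v∈ , _ , bounds = good A q∉ (u , u∈ , all u) in v , v∈ , bounds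

    -- With everything burnt, an unprocessed edge has two burnt ends, so some label can be raised by
    -- one; the result is a parking function strictly above `f`.
    maximal-processes-all : ∀ {f s} → IsMaximalParking G q f → Halted s → FollowsLabels f s →
                            ∀ e → e ∈ P s
    maximal-processes-all {f} {s} (pf , maximal) halted fl e with e ∈? P s
    ... | yes e∈ = e∈
    ... | no e∉ with refl ← parking-labels pf halted fl
        with bumpable (inv fl) e∉ (inj₁ refl) (parking-burns-all pf halted fl _)
                             (parking-burns-all pf halted fl _)
    ...   | w , k , _ , w≢q , eq , good-g =
          contradiction (ℤₚ.+-injective 1+k≡k) ℕₚ.1+n≢n
      where
      g = f [ w ]≔ + suc k
      f≼g : _≼_ G f g
      f≼g v with v ≟ w
      ... | yes refl rewrite lookup∘update v f (+ suc k) | eq = +≤+ (ℕₚ.n≤1+n k)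
      ... | no v≢w rewrite lookup∘update′ v≢w f (+ suc k) = ℤₚ.≤-refl
      g≡f : g ≡ f
      g≡f = maximal g (good-parking g (parking-burns-all pf halted fl)
                        (trans (lookup∘update′ (w≢q ∘ sym) f _) (proj₁ pf))
                        (λ v → ℤₚ.≤-trans (proj₁ (proj₂ pf) v) (f≼g v)) good-g) f≼g
      1+k≡k : + suc k ≡ + k
      1+k≡k = trans (sym (lookup∘update w f _)) (trans (cong (λ h → lookup h w) g≡f) eq)

    -- Every non-tree edge `e` was processed, hence rejected. Its cycle crosses the cut of that
    -- moment again in a tree edge, which is `σ`-larger.
    maximal-safe : ∀ f → IsMaximalParking G q f → Safe G σ (tree f)
    maximal-safe f mf e e∉ v es vs c =
      let s , _ , halted , fl = labelRun f
          B₀ , cut , low = safeCut (inv fl) (maximal-processes-all mf halted fl e) e∉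
          h , h∈ , h∈X , cut-h = chord-recrosses B₀ (acyclic (inv fl)) c cut
      in h , h∈ , low h (inj₁ h∈X) cut-h

    -- Runs driven by a tree

    record FollowsTree (T : Subset m) (s : State) : Set where
      field
        inv      : Inv s
        sound    : X s ⊆ T
        complete : ∀ {e} → e ∈ P s → e ∈ T → e ∈ X s

    followsTree-initial : ∀ T → FollowsTree T initial
    followsTree-initial T = record
      { inv = inv-initial ; sound = λ e∈ → contradiction e∈ ∉⊥ ; complete = λ e∈ _ → e∈ }

    followsTree-step : ∀ T {s e v} → Next s e v → FollowsTree T s → ∃[ s′ ] (Step s s′ × FollowsTree T s′)
    followsTree-step T {s} {e} {v} nx ft with e ∈? T
    ... | yes e∈T = accepted s e v , accept nx , record
      { inv = inv-accept nx (FollowsTree.inv ft)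
      ; sound = λ f∈ → [ FollowsTree.sound ft , (λ { refl → e∈T }) ]′ (⊕⁻ (X s) f∈)
      ; complete = λ f∈ f∈T → [ (λ f∈P → ⊕-old (FollowsTree.complete ft f∈P f∈T))
                              , (λ { refl → ⊕-new }) ]′ (⊕⁻ (P s) f∈) }
    ... | no e∉T = rejected s e , reject nx , record
      { inv = inv-reject nx (FollowsTree.inv ft)
      ; sound = FollowsTree.sound ft
      ; complete = λ f∈ f∈T → [ (λ f∈P → FollowsTree.complete ft f∈P f∈T)
                              , (λ { refl → contradiction f∈T e∉T }) ]′ (⊕⁻ (P s) f∈) }

    -- A walk in `T` from `q` to an unburnt vertex would leave `B s` by some edge: unprocessed, it
    -- contradicts the halt; processed, it was accepted and has both ends burnt.
    tree-burns-all : ∀ {T s} → ConnectedSub G T → Halted s → FollowsTree T s → ∀ v → v ∈ B s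
    tree-burns-all {T} {s} conn halted ft v with v ∈? B s
    ... | yes v∈ = v∈
    ... | no v∉ with conn q v
    ...   | _ , _ , w with walk-leaves (B s) w (root (FollowsTree.inv ft)) v∉
    ...     | e , e∈ , cut with e ∈? P s
    ...       | no e∉ = contradiction cut (halted e e∉)
    ...       | yes e∈P = contradiction cut
                  (inside-uncut (FollowsTree.inv ft) (FollowsTree.complete ft e∈P (walk-edges w e∈)))

    -- `X s` already links all vertices, so a further edge of `T` would close a cycle in `T`.
    tree-exhausted : ∀ {T s} → IsSpanningTree G T → Halted s → FollowsTree T s → X s ≡ T
    tree-exhausted {T} {s} (conn , acyc) halted ft = ⊆-antisym (FollowsTree.sound ft) T⊆X
      where
      burns = tree-burns-all conn halted ft
      T⊆X : T ⊆ X s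
      T⊆X {e} e∈T with e ∈? X s
      ... | yes e∈X = e∈X
      ... | no e∉X = contradiction acyc (linked-chord-closes-cycle (FollowsTree.sound ft)
                       (linked (FollowsTree.inv ft) (burns _) (burns _)) e∈T e∉X (inj₁ refl))

    -- The final labels of the run driven by `T` form a parking function. The run driven by that
    -- function ends with the same labels, hence in the same state and with the same tree.
    tree-surjective : ∀ T → IsSpanningTree G T → ∃[ f ] (IsParking G q f × tree f ≡ T)
    tree-surjective T isTree =
      let s , r , halted , ft =
            run-to-halt (FollowsTree T) (followsTree-step T) initial (followsTree-initial T)
          i  = FollowsTree.inv ft
          pf = good-parking (L s) (tree-burns-all (proj₁ isTree) halted ft)
                 (rootLabel i) (lowerBound i) (good i)
          s′ , r′ , halted′ , fl = labelRun (L s)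
          s′≡s = outcome-determines-run inv-initial r′ r halted′ halted
                   (inj₂ (parking-labels pf halted′ fl))
      in L s , pf , trans (cong X s′≡s) (tree-exhausted isTree halted ft)

mainTheorem7 : ∀ {n m} (G : Graph n m) → Connected G → (q : Fin n) →
    (σ : Fin m → ℕ) → Injective _≡_ _≡_ σ →
    Σ (Vec ℤ n → Subset m) λ π →
    (∀ f → IsParking G q f → IsSpanningTree G (π f)) ×
    (∀ f g → IsParking G q f → IsParking G q g → π f ≡ π g → f ≡ g) ×
    (∀ T → IsSpanningTree G T → ∃[ f ] (IsParking G q f × π f ≡ T)) ×
    (∀ f → IsMaximalParking G q f → Safe G σ (π f))
mainTheorem7 G _ q σ σ-injective = tree , parking-tree , tree-injective , tree-surjective , maximal-safe
  where open Burning G q σ σ-injective
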